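{- Let $\mathcal D=(\mathcal P,\mathcal B,\mathcal I)$ be a $2$-$(v,k,\lambda)$ design and let $G=\mathrm{Aut}(\mathcal D)$. Then $\mathcal D$ is trivial and $G$-pairwise transitive if and only if either (a) $k=2$ and $\lambda=1$; or (b) $k=v$ and $\lambda=|\mathcal B|$.
   Context: A design $\mathcal D=(\mathcal P,\mathcal B,\mathcal I)$ consists of finite sets $\mathcal P$ (points), $\mathcal B$ (blocks) and an incidence relation $\mathcal I\subseteq\mathcal P\times\mathcal B$. It is a $2$-$(v,k,\lambda)$ design if $|\mathcal P|=v$, each block is incident with exactly $k$ points ($k\ge2$), and each pair of distinct points is incident with exactly $\lambda$ common blocks. Distinct blocks may be incident with the same set of points. The design is non-trivial if $2<k<v$, and trivial otherwise. An automorphism is a permutation of $\mathcal P\cup\mathcal B$ leaving $\mathcal P$ and $\mathcal B$ invariant setwise and preserving incidence; $\mathrm{Aut}(\mathcal D)$ is the group of all automorphisms. Two blocks are intersecting if some point is incident with both. For $G\le\mathrm{Aut}(\mathcal D)$, the $2$-design $\mathcal D$ is $G$-pairwise transitive if $G$ is transitive on each of the following five (possibly empty) sets of ordered pairs: pairs of distinct points, incident point-block pairs, non-incident point-block pairs, pairs of distinct intersecting blocks, pairs of non-intersecting blocks.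
   Formalization: The block set is assumed non-empty; with no blocks the claim fails (v=3, k=2, λ=0, no blocks is trivial and pairwise transitive under Sym(3), but satisfies neither (a) nor (b)). -}

module Defs where

open import Algebra.Bundles using (Group)
open import Data.Empty using (⊥-elim)
open import Data.Fin.Base using (Fin)
open import Data.Nat.Base using (ℕ; _≤_; _<_)
open import Data.Product.Base using (∃; ∃-syntax; _×_; _,_)
open import Data.Sum.Base using (_⊎_; inj₁; inj₂)
open import Data.Unit.Base using (tt)
open import Function.Base using (id)
open import Function.Bundles using (_↔_; _⇔_; module Inverse; module Equivalence; mk⇔)
open import Function.Construct.Identity using (↔-id)
open import Function.Construct.Symmetry using (↔-sym)
open import Function.Construct.Composition using (_↔-∘_)
open import Level using (Level; 0ℓ; suc; _⊔_)
open import Relation.Binary.Core using (REL; Rel)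
open import Relation.Binary.Definitions using (Decidable; Irrelevant)
open import Relation.Binary.PropositionalEquality using (_≡_; _≢_; refl; sym; trans; cong)
open import Relation.Nullary.Negation.Core using (¬_)
open import Relation.Unary using (Pred; _∈_; U)

HasSize : Set → ℕ → Set
HasSize A n = A ↔ Fin n

-- Decidability and irrelevance of _I_ say that incidence is a subset of the
-- finite set Point × Block.  Blocks are not identified with their point sets,
-- so repeated blocks are allowed.
record Design : Set₁ where
  field
    Point         : Set
    Block         : Set
    _I_           : REL Point Block 0ℓ
    I-dec         : Decidable _I_
    I-irrelevant  : Irrelevant _I_
    numPoints     : ℕ
    numBlocks     : ℕ
    points-finite : HasSize Point numPoints
    blocks-finite : HasSize Block numBlocks

  Intersecting : Rel Block 0ℓ
  Intersecting β γ = ∃[ p ] (p I β × p I γ)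

record Is2Design (D : Design) (v k lam : ℕ) : Set where
  open Design D
  field
    v-points   : numPoints ≡ v
    2≤k        : 2 ≤ k
    block-size : ∀ β → HasSize (∃[ p ] p I β) k
    pair-count : ∀ p q → p ≢ q → HasSize (∃[ β ] (p I β × q I β)) lam

NonTrivial : (v k : ℕ) → Set
NonTrivial v k = 2 < k × k < v

Trivial : (v k : ℕ) → Set
Trivial v k = ¬ NonTrivial v k

module _ (D : Design) where
  open Design D

  Vertex : Set
  Vertex = Point ⊎ Block

  -- As π is a bijection of the disjoint union, mapping each of the two parts
  -- into itself amounts to leaving both invariant setwise.
  record IsAutomorphism (π : Vertex ↔ Vertex) : Set where
    open Inverse π using (to)
    field
      points-invariant : ∀ p → ∃[ q ] to (inj₁ p) ≡ inj₁ q
      blocks-invariant : ∀ β → ∃[ γ ] to (inj₂ β) ≡ inj₂ γ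
      preserves-I      : ∀ {p β q γ} → to (inj₁ p) ≡ inj₁ q → to (inj₂ β) ≡ inj₂ γ →
                         p I β ⇔ q I γ

  record Automorphism : Set where
    field
      perm           : Vertex ↔ Vertex
      isAutomorphism : IsAutomorphism perm

    open Inverse perm public using (to; from; strictlyInverseˡ; strictlyInverseʳ)
    open IsAutomorphism isAutomorphism public

  open Automorphism using (perm; to; from; strictlyInverseˡ; strictlyInverseʳ; points-invariant; blocks-invariant; preserves-I)

  idᴬ : Automorphism
  idᴬ = record
    { perm           = ↔-id Vertex
    ; isAutomorphism = record
      { points-invariant = λ p → p , refl
      ; blocks-invariant = λ β → β , refl
      ; preserves-I      = λ { refl refl → mk⇔ id id }
      }
    }

  _∘ᴬ_ : Automorphism → Automorphism → Automorphism
  g ∘ᴬ h = record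
    { perm           = perm g ↔-∘ perm h
    ; isAutomorphism = record
      { points-invariant = pts
      ; blocks-invariant = bls
      ; preserves-I      = pres
      }
    }
    where
    pts : ∀ p → ∃[ q ] to g (to h (inj₁ p)) ≡ inj₁ q
    pts p with points-invariant h p
    ... | q , e with points-invariant g q
    ...   | r , e′ = r , trans (cong (to g) e) e′

    bls : ∀ β → ∃[ γ ] to g (to h (inj₂ β)) ≡ inj₂ γ
    bls β with blocks-invariant h β
    ... | γ , e with blocks-invariant g γ
    ...   | δ , e′ = δ , trans (cong (to g) e) e′

    pres : ∀ {p β q γ} → to g (to h (inj₁ p)) ≡ inj₁ q → to g (to h (inj₂ β)) ≡ inj₂ γ →
           p I β ⇔ q I γ
    pres {p} {β} ep eβ with points-invariant h p | blocks-invariant h β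
    ... | q′ , e₁ | γ′ , e₂ = mk⇔
      (λ i → Equivalence.to G (Equivalence.to H i))
      (λ i → Equivalence.from H (Equivalence.from G i))
      where
      H = preserves-I h e₁ e₂
      G = preserves-I g (trans (cong (to g) (sym e₁)) ep) (trans (cong (to g) (sym e₂)) eβ)

  _⁻¹ᴬ : Automorphism → Automorphism
  g ⁻¹ᴬ = record
    { perm           = ↔-sym (perm g)
    ; isAutomorphism = record
      { points-invariant = pts
      ; blocks-invariant = bls
      ; preserves-I      = λ ep eβ → flip⇔ (preserves-I g (back ep) (back eβ))
      }
    }
    where
    flip⇔ : ∀ {A B : Set} → A ⇔ B → B ⇔ A
    flip⇔ e = mk⇔ (Equivalence.from e) (Equivalence.to e)

    back : ∀ {x y} → from g x ≡ y → to g y ≡ x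
    back {x} e = trans (cong (to g) (sym e)) (strictlyInverseˡ g x)

    inj₁≢inj₂ : ∀ {p : Point} {β : Block} → _≢_ {A = Vertex} (inj₁ p) (inj₂ β)
    inj₁≢inj₂ ()

    pts : ∀ p → ∃[ q ] from g (inj₁ p) ≡ inj₁ q
    pts p with from g (inj₁ p) in e
    ... | inj₁ q = q , refl
    ... | inj₂ β with blocks-invariant g β
    ...   | γ , e′ = ⊥-elim (inj₁≢inj₂ (trans (sym (back e)) e′))

    bls : ∀ β → ∃[ γ ] from g (inj₂ β) ≡ inj₂ γ
    bls β with from g (inj₂ β) in e
    ... | inj₂ γ = γ , refl
    ... | inj₁ p with points-invariant g p
    ...   | q , e′ = ⊥-elim (inj₁≢inj₂ (trans (sym e′) (back e)))

  Aut : Group 0ℓ 0ℓ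
  Aut = record
    { Carrier = Automorphism
    ; _≈_     = λ g h → ∀ x → to g x ≡ to h x
    ; _∙_     = _∘ᴬ_
    ; ε       = idᴬ
    ; _⁻¹     = _⁻¹ᴬ
    ; isGroup = record
      { isMonoid = record
        { isSemigroup = record
          { isMagma = record
            { isEquivalence = record
              { refl  = λ _ → refl
              ; sym   = λ e x → sym (e x)
              ; trans = λ e f x → trans (e x) (f x)
              }
            ; ∙-cong = λ {g} {g′} {h} {h′} e f x → trans (e (to h x)) (cong (to g′) (f x))
            }
          ; assoc = λ _ _ _ _ → refl
          }
        ; identity = (λ _ _ → refl) , (λ _ _ → refl)
        }
      ; inverse = strictlyInverseʳ , strictlyInverseˡ
      ; ⁻¹-cong = λ {g} {h} e x →
          trans (sym (strictlyInverseʳ h (from g x)))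
                (cong (from h) (trans (sym (e (from g x))) (strictlyInverseˡ g x)))
      }
    }

record Subgroup {c ℓ : Level} (A : Group c ℓ) (s : Level) : Set (c ⊔ ℓ ⊔ suc s) where
  open Group A
  field
    Member    : Pred Carrier s
    resp-≈    : ∀ {g h} → g ≈ h → g ∈ Member → h ∈ Member
    ε-closed  : ε ∈ Member
    ∙-closed  : ∀ {g h} → g ∈ Member → h ∈ Member → (g ∙ h) ∈ Member
    ⁻¹-closed : ∀ {g} → g ∈ Member → (g ⁻¹) ∈ Member

whole : ∀ {c ℓ} (A : Group c ℓ) → Subgroup A 0ℓ
whole A = record
  { Member    = U
  ; resp-≈    = λ _ _ → tt
  ; ε-closed  = tt
  ; ∙-closed  = λ _ _ → tt
  ; ⁻¹-closed = λ _ → tt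
  }

module _ (D : Design) {s : Level} (G : Subgroup (Aut D) s) where
  open Design D
  open Subgroup G using (Member)
  open Automorphism using (to)

  -- Transitivity of G on the set of ordered pairs (ι x , κ y) with R x y;
  -- it holds vacuously when that set is empty.
  TransitiveOnPairs : {X Y : Set} (ι : X → Vertex D) (κ : Y → Vertex D) (R : REL X Y 0ℓ) → Set s
  TransitiveOnPairs ι κ R = ∀ {x y x′ y′} → R x y → R x′ y′ →
    ∃[ g ] (g ∈ Member × to g (ι x) ≡ ι x′ × to g (κ y) ≡ κ y′)

  record PairwiseTransitive : Set s where
    field
      distinct-points       : TransitiveOnPairs inj₁ inj₁ _≢_
      flags                 : TransitiveOnPairs inj₁ inj₂ _I_
      antiflags             : TransitiveOnPairs inj₁ inj₂ (λ p β → ¬ p I β)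
      intersecting-blocks   : TransitiveOnPairs inj₂ inj₂ (λ β γ → β ≢ γ × Intersecting β γ)
      nonintersecting-blocks : TransitiveOnPairs inj₂ inj₂ (λ β γ → ¬ Intersecting β γ)

{-# OPTIONS --safe #-}

-- If k = v, every point lies on every block, so any permutation of the points
-- together with any permutation of the blocks is an automorphism.  If k = 2 and
-- λ = 1, the blocks are the unordered pairs of points, so every permutation of
-- the points extends to the blocks, and the five transitivity conditions follow
-- from the 4-fold transitivity of the symmetric group.  Conversely, if
-- k = 2 < v and λ ≥ 2, then two blocks with the same two points and two blocks
-- with a single common point are intersecting pairs that no automorphism can
-- map to each other.
module Submission where

open import Defs
open import Data.Bool.Base using (if_then_else_)
open import Data.Fin.Base using (Fin; zero; suc; fromℕ<)
open import Data.Fin.Properties using (inj⇒≟; injective⇒≤; ¬∀⟶∃¬)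
open import Data.Fin.Permutation using (↔⇒≡)
open import Data.Nat.Base using (ℕ; _<_; _≤_; zero; suc; s≤s)
open import Data.Nat.Properties using (1+n≰n; ≤⇒≯; ≤∧≢⇒<; _≟_; <-irrefl)
open import Data.Product.Base using (_×_; _,_; ∃; ∃-syntax; proj₁; proj₂)
open import Data.Sum.Base using (_⊎_; inj₁; inj₂)
open import Data.Sum.Function.Propositional using (_⊎-↔_)
open import Data.Sum.Properties using (inj₁-injective)
open import Data.Unit.Base using (tt)
open import Data.Vec.Base using (Vec; []; _∷_)
open import Data.Vec.Relation.Binary.Pointwise.Inductive using (Pointwise; []; _∷_)
open import Data.Vec.Relation.Unary.All using (All; []; _∷_)
open import Data.Vec.Relation.Unary.AllPairs using ([]; _∷_)
open import Data.Vec.Relation.Unary.Unique.Propositional using (Unique)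
open import Function.Base using (_∘_)
open import Function.Bundles using (_↔_; _⇔_; mk⇔; mk↔ₛ′; module Inverse; module Equivalence; module Injection)
open import Function.Construct.Composition using (_↔-∘_)
open import Function.Construct.Identity using (↔-id)
open import Function.Construct.Symmetry using (↔-sym)
open import Function.Definitions using (Injective)
open import Function.Properties.Inverse using (↔⇒↣)
open import Level using (0ℓ)
open import Relation.Binary.Definitions using (DecidableEquality)
open import Relation.Binary.PropositionalEquality using (_≡_; _≢_; refl; sym; trans; cong; cong₂; subst; subst₂; ≢-sym)
open import Relation.Nullary.Decidable using (yes; no; does; dec-true; dec-false; decidable-stable)
open import Relation.Nullary.Negation.Core using (¬_; contradiction)
open import Relation.Unary using (Pred; Decidable; Irrelevant)

open Inverse using (to; from; strictlyInverseˡ; strictlyInverseʳ)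

private
  variable
    A B : Set
    m n : ℕ

↔-injective : (e : A ↔ B) → Injective _≡_ _≡_ (to e)
↔-injective e = Injection.injective (↔⇒↣ e)

-- Transitivity of the symmetric group

module _ (_≟ᴬ_ : DecidableEquality A) where

  swap : A → A → A → A
  swap a b c = if does (c ≟ᴬ a) then b else if does (c ≟ᴬ b) then a else c

  swap-left : ∀ a b → swap a b a ≡ b
  swap-left a b rewrite dec-true (a ≟ᴬ a) refl = refl

  swap-right : ∀ a b → swap a b b ≡ a
  swap-right a b with b ≟ᴬ a
  ... | yes b≡a = b≡a
  ... | no  _ rewrite dec-true (b ≟ᴬ b) refl = refl

  swap-other : ∀ {a b c} → c ≢ a → c ≢ b → swap a b c ≡ c
  swap-other {a} {b} {c} c≢a c≢b
    rewrite dec-false (c ≟ᴬ a) c≢a | dec-false (c ≟ᴬ b) c≢b = refl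

  swap-involutive : ∀ a b c → swap a b (swap a b c) ≡ c
  swap-involutive a b c with c ≟ᴬ a | c ≟ᴬ b
  ... | yes refl | _        = swap-right c b
  ... | no _     | yes refl = swap-left a c
  ... | no c≢a   | no c≢b   = swap-other c≢a c≢b

  transposition : A → A → A ↔ A
  transposition a b =
    mk↔ₛ′ (swap a b) (swap a b) (swap-involutive a b) (swap-involutive a b)

  -- After `σ`, swapping `to σ x` with `y` corrects the image of `x` and disturbs no earlier match:
  -- an image `to σ a` differs from `to σ x` by injectivity, and from `y` because `y` does not occur
  -- in `ys`.
  transposition-fixes : (σ : A ↔ A) {x y : A} {xs ys : Vec A n} →
    All (x ≢_) xs → All (y ≢_) ys → Pointwise (λ a b → to σ a ≡ b) xs ys →
    Pointwise (λ a b → swap (to σ x) y (to σ a) ≡ b) xs ys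
  transposition-fixes σ []          []          []         = []
  transposition-fixes σ {x} {y} (x≢a ∷ x≢xs) (y≢b ∷ y≢ys) (refl ∷ es) =
    swap-other (x≢a ∘ sym ∘ ↔-injective σ) (≢-sym y≢b)
    ∷ transposition-fixes σ x≢xs y≢ys es

  symmetric-transitive : {xs ys : Vec A n} → Unique xs → Unique ys →
    ∃[ σ ] Pointwise (λ a b → to σ a ≡ b) xs ys
  symmetric-transitive {xs = []}    {[]}     []       []       = ↔-id A , []
  symmetric-transitive {xs = x ∷ _} {y ∷ _} (x≢ ∷ ux) (y≢ ∷ uy)
    with symmetric-transitive ux uy
  ... | σ , es = transposition (to σ x) y ↔-∘ σ
               , swap-left (to σ x) y ∷ transposition-fixes σ x≢ y≢ es

-- Finite sets and their decidable subsets

size⇒≟ : HasSize A n → DecidableEquality A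
size⇒≟ e = inj⇒≟ (↔⇒↣ e)

injective⇒size-≤ : HasSize A m → HasSize B n →
  {f : A → B} → Injective _≡_ _≡_ f → m ≤ n
injective⇒size-≤ a b inj =
  injective⇒≤ (↔-injective (↔-sym a) ∘ inj ∘ ↔-injective b)

Fin2-exhausted : {i j : Fin 2} → i ≢ j → ∀ l → l ≡ i ⊎ l ≡ j
Fin2-exhausted {zero}     {zero}     i≢j _          = contradiction refl i≢j
Fin2-exhausted {suc zero} {suc zero} i≢j _          = contradiction refl i≢j
Fin2-exhausted {zero}     {suc zero} _   zero       = inj₁ refl
Fin2-exhausted {zero}     {suc zero} _   (suc zero) = inj₂ refl
Fin2-exhausted {suc zero} {zero}     _   zero       = inj₂ refl
Fin2-exhausted {suc zero} {zero}     _   (suc zero) = inj₁ refl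

module _ {P : Pred A 0ℓ} (irr : Irrelevant P) where

  ∃-injective : Injective _≡_ _≡_ (proj₁ {B = P})
  ∃-injective {a , p} {_ , q} refl = cong (a ,_) (irr p q)

  two-elements : HasSize (∃ P) (suc (suc n)) → ∃[ a ] ∃[ b ] (a ≢ b × P a × P b)
  two-elements e with from e zero in eq₀ | from e (suc zero) in eq₁
  ... | a , pa | b , pb = a , b , a≢b , pa , pb
    where
    a≢b : a ≢ b
    a≢b a≡b with () ← ↔-injective (↔-sym e) (trans eq₀ (trans (∃-injective a≡b) (sym eq₁)))

  size-2-exhausted : HasSize (∃ P) 2 →
    ∀ {a b c} → a ≢ b → P a → P b → P c → c ≡ a ⊎ c ≡ b
  size-2-exhausted e {a} {b} {c} a≢b pa pb pc
    with Fin2-exhausted (a≢b ∘ cong proj₁ ∘ ↔-injective e {a , pa} {b , pb}) (to e (c , pc))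
  ... | inj₁ eq = inj₁ (cong proj₁ (↔-injective e eq))
  ... | inj₂ eq = inj₂ (cong proj₁ (↔-injective e eq))

  subset-size-≤ : HasSize A n → HasSize (∃ P) m → m ≤ n
  subset-size-≤ a e = injective⇒size-≤ e a ∃-injective

  -- Pigeonhole: an `x` outside `P`, put in front of the `n` elements of `P`, would give `n + 1`
  -- distinct elements of `A`.
  full-size⇒all : Decidable P → HasSize A n → HasSize (∃ P) n → ∀ x → P x
  full-size⇒all {n} P? a e x = decidable-stable (P? x) λ ¬px →
    1+n≰n (injective⇒≤ (cons-injective ¬px ∘ ↔-injective a))
    where
    cons : Fin (suc n) → A
    cons zero    = x
    cons (suc i) = proj₁ (from e i)

    cons-injective : ¬ P x → {i j : Fin (suc n)} → cons i ≡ cons j → i ≡ j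
    cons-injective ¬px {zero}  {zero}  _  = refl
    cons-injective ¬px {zero}  {suc j} eq = contradiction (subst P (sym eq) (proj₂ (from e j))) ¬px
    cons-injective ¬px {suc i} {zero}  eq = contradiction (subst P eq (proj₂ (from e i))) ¬px
    cons-injective ¬px {suc i} {suc j} eq = cong suc (↔-injective (↔-sym e) (∃-injective eq))

-- If `P` held throughout, `A` would embed in `∃ P`, forcing `n ≤ m`. The counterexample is found by
-- searching `Fin n`.
smaller-size⇒∃¬ : {P : Pred A 0ℓ} → Decidable P → HasSize A n → HasSize (∃ P) m →
  m < n → ∃[ x ] ¬ P x
smaller-size⇒∃¬ {P = P} P? a e m<n
  with ¬∀⟶∃¬ _ (P ∘ from a) (P? ∘ from a) (λ all → ≤⇒≯ (n≤m all) m<n)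
  where
  n≤m : (∀ i → P (from a i)) → _ ≤ _
  n≤m all = injective⇒≤ {f = λ i → to e (from a i , all i)}
    (↔-injective (↔-sym a) ∘ cong proj₁ ∘ ↔-injective e)
... | i , ¬p = from a i , ¬p

-- Automorphisms of designs

module _ (D : Design) where
  open Design D

  automorphism : (σ : Point ↔ Point) (τ : Block ↔ Block) →
    (∀ p β → p I β ⇔ to σ p I to τ β) → Automorphism D
  automorphism σ τ pres = record
    { perm           = σ ⊎-↔ τ
    ; isAutomorphism = record
      { points-invariant = λ p → to σ p , refl
      ; blocks-invariant = λ β → to τ β , refl
      ; preserves-I      = λ { {p} {β} refl refl → pres p β }
      }
    }

  _≟ᵖ_ : DecidableEquality Point
  _≟ᵖ_ = size⇒≟ points-finite

  _≟ᵇ_ : DecidableEquality Block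
  _≟ᵇ_ = size⇒≟ blocks-finite

  -- Designs in which every point lies on every block

  full⇒pairwiseTransitive : Point → (∀ p β → p I β) → PairwiseTransitive D (whole (Aut D))
  full⇒pairwiseTransitive o full = record
    { distinct-points        = points
    ; flags                  = flags
    ; antiflags              = λ ¬i _ → contradiction (full _ _) ¬i
    ; intersecting-blocks    = blocks
    -- The point `o` lies on every block, so no pair is non-intersecting.
    ; nonintersecting-blocks = λ ¬i _ → contradiction (o , full o _ , full o _) ¬i
    }
    where
    aut : Point ↔ Point → Block ↔ Block → Automorphism D
    aut σ τ = automorphism σ τ (λ _ _ → mk⇔ (λ _ → full _ _) (λ _ → full _ _))

    points : TransitiveOnPairs D (whole (Aut D)) inj₁ inj₁ _≢_
    points p≢q p′≢q′
      with symmetric-transitive _≟ᵖ_ ((p≢q ∷ []) ∷ [] ∷ []) ((p′≢q′ ∷ []) ∷ [] ∷ [])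
    ... | σ , ep ∷ eq ∷ [] = aut σ (↔-id Block) , tt , cong inj₁ ep , cong inj₁ eq

    flags : TransitiveOnPairs D (whole (Aut D)) inj₁ inj₂ _I_
    flags {p} {β} {p′} {β′} _ _ =
      aut (transposition _≟ᵖ_ p p′) (transposition _≟ᵇ_ β β′) , tt
      , cong inj₁ (swap-left _≟ᵖ_ p p′) , cong inj₂ (swap-left _≟ᵇ_ β β′)

    blocks : TransitiveOnPairs D (whole (Aut D)) inj₂ inj₂ (λ β γ → β ≢ γ × Intersecting β γ)
    blocks (β≢γ , _) (β′≢γ′ , _)
      with symmetric-transitive _≟ᵇ_ ((β≢γ ∷ []) ∷ [] ∷ []) ((β′≢γ′ ∷ []) ∷ [] ∷ [])
    ... | τ , eβ ∷ eγ ∷ [] = aut (↔-id Point) τ , tt , cong inj₂ eβ , cong inj₂ eγ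

  -- The case k = 2 and λ = 1, where the blocks are the edges of a complete graph.
  module CompleteGraph
    (join          : ∀ {p q} → p ≢ q → ∃[ β ] (p I β × q I β))
    (join-unique   : ∀ {p q β γ} → p ≢ q → p I β → q I β → p I γ → q I γ → β ≡ γ)
    (ends          : ∀ β → ∃[ p ] ∃[ q ] (p ≢ q × p I β × q I β))
    (ends-complete : ∀ {β p q r} → p ≢ q → p I β → q I β → r I β → r ≡ p ⊎ r ≡ q)
    where

    -- The block joining the images of two chosen ends. Carrying incidence for every point of `β`
    -- makes later arguments independent of that choice.
    image : (σ : Point ↔ Point) (β : Block) → ∃[ γ ] (∀ {r} → r I β → to σ r I γ)
    image σ β with ends β
    ... | p , q , p≢q , pβ , qβ with join (p≢q ∘ ↔-injective σ)
    ...   | γ , σpγ , σqγ = γ , inc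
      where
      inc : ∀ {r} → r I β → to σ r I γ
      inc rβ with ends-complete p≢q pβ qβ rβ
      ... | inj₁ refl = σpγ
      ... | inj₂ refl = σqγ

    image-unique : (σ : Point ↔ Point) {p q : Point} {β γ : Block} → p ≢ q →
      p I β → q I β → to σ p I γ → to σ q I γ → proj₁ (image σ β) ≡ γ
    image-unique σ {β = β} p≢q pβ qβ =
      join-unique (p≢q ∘ ↔-injective σ) (proj₂ (image σ β) pβ) (proj₂ (image σ β) qβ)

    -- `ρ` brings the images of two ends of `β` back to those ends, and two points determine a
    -- block. Stated one-sidedly, it serves both round trips of `τ` in `induced`.
    image-inverse : (σ ρ : Point ↔ Point) → (∀ p → to ρ (to σ p) ≡ p) →
      ∀ β → proj₁ (image ρ (proj₁ (image σ β))) ≡ β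
    image-inverse σ ρ ρσ β =
      let p , q , p≢q , pβ , qβ = ends β
          γ , inc               = image σ β
      in image-unique ρ (p≢q ∘ ↔-injective σ) (inc pβ) (inc qβ)
           (subst (_I β) (sym (ρσ p)) pβ) (subst (_I β) (sym (ρσ q)) qβ)

    induced : Point ↔ Point → Automorphism D
    -- Incidence is reflected by applying preservation for `σ⁻¹` and cancelling on points and on
    -- blocks.
    induced σ = automorphism σ τ λ p β → mk⇔ (proj₂ (image σ β)) λ i →
      subst₂ _I_ (strictlyInverseʳ σ p) (strictlyInverseʳ τ β)
        (proj₂ (image σ⁻¹ (to τ β)) i)
      where
      σ⁻¹ = ↔-sym σ
      τ : Block ↔ Block
      τ = mk↔ₛ′ (proj₁ ∘ image σ) (proj₁ ∘ image σ⁻¹)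
        (image-inverse σ⁻¹ σ (strictlyInverseˡ σ)) (image-inverse σ σ⁻¹ (strictlyInverseʳ σ))

    -- Reduces the transport of a block to that of two points on it, so that transitivity on pairs
    -- involving blocks becomes transitivity on tuples of points.
    induced-block : (σ : Point ↔ Point) {p q p′ q′ : Point} {β β′ : Block} → p ≢ q →
      p I β → q I β → p′ I β′ → q′ I β′ → to σ p ≡ p′ → to σ q ≡ q′ →
      Automorphism.to (induced σ) (inj₂ β) ≡ inj₂ β′
    induced-block σ p≢q pβ qβ pβ′ qβ′ refl refl =
      cong inj₂ (image-unique σ p≢q pβ qβ pβ′ qβ′)

    other-end : ∀ {p β} → p I β → ∃[ q ] (p ≢ q × q I β)
    other-end {p} {β} pβ with ends β
    ... | a , b , a≢b , aβ , bβ with ends-complete a≢b aβ bβ pβ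
    ...   | inj₁ refl = b , a≢b , bβ
    ...   | inj₂ refl = a , ≢-sym a≢b , aβ

    ∉⇒≢ : ∀ {p q β} → ¬ p I β → q I β → p ≢ q
    ∉⇒≢ ¬pβ qβ refl = ¬pβ qβ

    -- Two edges sharing the vertex `p` form a path centred at `p`; its outer ends differ, since
    -- otherwise both blocks would join the same two points. The centre is listed first, so a
    -- permutation matching two such triples matches the shared points.
    intersecting⇒path : ∀ {β γ} → β ≢ γ → Intersecting β γ → ∃[ p ] ∃[ q ] ∃[ r ]
      (Unique (p ∷ q ∷ r ∷ []) × p I β × q I β × p I γ × r I γ)
    intersecting⇒path β≢γ (p , pβ , pγ) with other-end pβ | other-end pγ
    ... | q , p≢q , qβ | r , p≢r , rγ =
      p , q , r , (p≢q ∷ p≢r ∷ []) ∷ (q≢r ∷ []) ∷ [] ∷ [] , pβ , qβ , pγ , rγ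
      where
      q≢r : q ≢ r
      q≢r refl = β≢γ (join-unique p≢q pβ qβ pγ rγ)

    -- Disjoint edges have four distinct ends; this case calls for 4-fold transitivity.
    nonintersecting⇒matching : ∀ {β γ} → ¬ Intersecting β γ → ∃[ p ] ∃[ q ] ∃[ r ] ∃[ s ]
      (Unique (p ∷ q ∷ r ∷ s ∷ []) × p I β × q I β × r I γ × s I γ)
    nonintersecting⇒matching {β} {γ} disjoint with ends β | ends γ
    ... | p , q , p≢q , pβ , qβ | r , s , r≢s , rγ , sγ =
      p , q , r , s
      , (p≢q ∷ apart pβ rγ ∷ apart pβ sγ ∷ []) ∷ (apart qβ rγ ∷ apart qβ sγ ∷ [])
        ∷ (r≢s ∷ []) ∷ [] ∷ []
      , pβ , qβ , rγ , sγ
      where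
      apart : ∀ {a b} → a I β → b I γ → a ≢ b
      apart aβ bγ refl = disjoint (_ , aβ , bγ)

    pairwiseTransitive : PairwiseTransitive D (whole (Aut D))
    pairwiseTransitive = record
      { distinct-points        = points
      ; flags                  = flags
      ; antiflags              = antiflags
      ; intersecting-blocks    = intersecting
      ; nonintersecting-blocks = nonintersecting
      }
      where
      points : TransitiveOnPairs D (whole (Aut D)) inj₁ inj₁ _≢_
      points p≢q p′≢q′
        with symmetric-transitive _≟ᵖ_ ((p≢q ∷ []) ∷ [] ∷ []) ((p′≢q′ ∷ []) ∷ [] ∷ [])
      ... | σ , ep ∷ eq ∷ [] = induced σ , tt , cong inj₁ ep , cong inj₁ eq

      flags : TransitiveOnPairs D (whole (Aut D)) inj₁ inj₂ _I_
      flags pβ p′β′ with other-end pβ | other-end p′β′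
      ... | q , p≢q , qβ | q′ , p′≢q′ , q′β′
        with symmetric-transitive _≟ᵖ_ ((p≢q ∷ []) ∷ [] ∷ []) ((p′≢q′ ∷ []) ∷ [] ∷ [])
      ...   | σ , ep ∷ eq ∷ [] =
        induced σ , tt , cong inj₁ ep , induced-block σ p≢q pβ qβ p′β′ q′β′ ep eq

      antiflags : TransitiveOnPairs D (whole (Aut D)) inj₁ inj₂ (λ p β → ¬ p I β)
      antiflags {x} {β} {x′} {β′} ¬xβ ¬x′β′ with ends β | ends β′
      ... | p , q , p≢q , pβ , qβ | p′ , q′ , p′≢q′ , p′β′ , q′β′
        with symmetric-transitive _≟ᵖ_
          ((∉⇒≢ ¬xβ pβ ∷ ∉⇒≢ ¬xβ qβ ∷ []) ∷ (p≢q ∷ []) ∷ [] ∷ [])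
          ((∉⇒≢ ¬x′β′ p′β′ ∷ ∉⇒≢ ¬x′β′ q′β′ ∷ []) ∷ (p′≢q′ ∷ []) ∷ [] ∷ [])
      ...   | σ , ex ∷ ep ∷ eq ∷ [] =
        induced σ , tt , cong inj₁ ex , induced-block σ p≢q pβ qβ p′β′ q′β′ ep eq

      intersecting : TransitiveOnPairs D (whole (Aut D)) inj₂ inj₂ (λ β γ → β ≢ γ × Intersecting β γ)
      intersecting (β≢γ , i) (β′≢γ′ , i′) with intersecting⇒path β≢γ i | intersecting⇒path β′≢γ′ i′
      ... | _ , _ , _ , u@((p≢q ∷ p≢r ∷ []) ∷ _) , pβ , qβ , pγ , rγ
          | _ , _ , _ , u′ , p′β′ , q′β′ , p′γ′ , r′γ′
        with symmetric-transitive _≟ᵖ_ u u′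
      ...   | σ , ep ∷ eq ∷ er ∷ [] = induced σ , tt
        , induced-block σ p≢q pβ qβ p′β′ q′β′ ep eq , induced-block σ p≢r pγ rγ p′γ′ r′γ′ ep er

      nonintersecting : TransitiveOnPairs D (whole (Aut D)) inj₂ inj₂ (λ β γ → ¬ Intersecting β γ)
      nonintersecting d d′ with nonintersecting⇒matching d | nonintersecting⇒matching d′
      ... | _ , _ , _ , _ , u@((p≢q ∷ _) ∷ _ ∷ (r≢s ∷ []) ∷ _) , pβ , qβ , rγ , sγ
          | _ , _ , _ , _ , u′ , p′β′ , q′β′ , r′γ′ , s′γ′
        with symmetric-transitive _≟ᵖ_ u u′
      ...   | σ , ep ∷ eq ∷ er ∷ es ∷ [] = induced σ , tt
        , induced-block σ p≢q pβ qβ p′β′ q′β′ ep eq , induced-block σ r≢s rγ sγ r′γ′ s′γ′ er es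

-- Incidence structure forced by the parameters `v`, `k` and `lam`

module _ {D : Design} where
  open Design D
  open Is2Design

  private
    variable
      v k lam : ℕ

  pair-irrelevant : ∀ p q → Irrelevant (λ β → p I β × q I β)
  pair-irrelevant p q (a , b) (a′ , b′) = cong₂ _,_ (I-irrelevant a a′) (I-irrelevant b b′)

  block-pair : Is2Design D v k lam → ∀ β → ∃[ p ] ∃[ q ] (p ≢ q × p I β × q I β)
  block-pair des β with 2≤k des
  ... | s≤s (s≤s _) = two-elements I-irrelevant (block-size des β)

  k≡v⇒full : Is2Design D v k lam → k ≡ v → ∀ p β → p I β
  k≡v⇒full des refl p β = full-size⇒all I-irrelevant (λ q → I-dec q β)
    (subst (HasSize Point) (v-points des) points-finite) (block-size des β) p

  -- The given block supplies two distinct points, and the blocks through both are all the blocks.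
  full⇒lam≡numBlocks : Is2Design D v k lam → Block → (∀ p β → p I β) → lam ≡ numBlocks
  full⇒lam≡numBlocks des β full with block-pair des β
  ... | p , q , p≢q , _ =
    ↔⇒≡ (blocks-finite ↔-∘ (all ↔-∘ ↔-sym (pair-count des p q p≢q)))
    where
    all : (∃[ γ ] (p I γ × q I γ)) ↔ Block
    all = mk↔ₛ′ proj₁ (λ γ → γ , full p γ , full q γ) (λ _ → refl)
      (λ _ → ∃-injective (pair-irrelevant p q) refl)

  edges-pairwiseTransitive : Is2Design D v 2 1 → PairwiseTransitive D (whole (Aut D))
  edges-pairwiseTransitive des = CompleteGraph.pairwiseTransitive D join join-unique
    (block-pair des) (λ {β} → size-2-exhausted I-irrelevant (block-size des β))
    where
    join : ∀ {p q} → p ≢ q → ∃[ β ] (p I β × q I β)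
    join p≢q = from (pair-count des _ _ p≢q) zero

    Fin1-unique : (i j : Fin 1) → i ≡ j
    Fin1-unique zero zero = refl

    join-unique : ∀ {p q β γ} → p ≢ q → p I β → q I β → p I γ → q I γ → β ≡ γ
    join-unique p≢q pβ qβ pγ qγ =
      cong proj₁ (↔-injective (pair-count des _ _ p≢q) {_ , pβ , qβ} {_ , pγ , qγ} (Fin1-unique _ _))

  -- An automorphism taking (β , γ) to (β , δ) would carry the two common points
  -- of β and γ to two common points of β and δ, but δ meets β in one point only.
  repeated-edge⇒¬transitive : Is2Design D v 2 (suc (suc n)) → 2 < v → Block →
    ¬ PairwiseTransitive D (whole (Aut D))
  repeated-edge⇒¬transitive des 2<v β₀ pt with block-pair des β₀
  ... | p , q , p≢q , _
    with two-elements (pair-irrelevant p q) (pair-count des p q p≢q)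
  ... | β , γ , β≢γ , (pβ , qβ) , (pγ , qγ)
    with smaller-size⇒∃¬ (λ x → I-dec x β)
           (subst (HasSize Point) (v-points des) points-finite) (block-size des β) 2<v
  -- A third point `r` off `β` yields the comparison block `δ` through `p` and `r`; it exists
  -- because the pair count is positive.
  ... | r , ¬rβ with from (pair-count des p r λ { refl → ¬rβ pβ }) zero
  ... | δ , pδ , rδ
    with PairwiseTransitive.intersecting-blocks pt
           (β≢γ , p , pβ , pγ) ((λ { refl → ¬rβ rδ }) , p , pβ , pδ)
  ... | g , _ , gβ , gγ
    with Automorphism.points-invariant g p | Automorphism.points-invariant g q
  ... | p′ , gp | q′ , gq = ¬rβ rβ
    where
    moves : ∀ {x y ε ζ} → Automorphism.to g (inj₁ x) ≡ inj₁ y →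
            Automorphism.to g (inj₂ ε) ≡ inj₂ ζ → x I ε → y I ζ
    moves ex eε = Equivalence.to (Automorphism.preserves-I g ex eε)

    p′≢q′ : p′ ≢ q′
    p′≢q′ refl = p≢q (inj₁-injective (↔-injective (Automorphism.perm g) (trans gp (sym gq))))

    rβ : r I β
    -- `p′` and `q′` are the only points of `δ`, so `r` is one of them; both lie on `β`, which `g`
    -- fixes.
    rβ with size-2-exhausted I-irrelevant (block-size des δ) p′≢q′
              (moves gp gγ pγ) (moves gq gγ qγ) rδ
    ... | inj₁ refl = moves gp gβ pβ
    ... | inj₂ refl = moves gq gβ qβ

  transitive-edges⇒lam≡1 : Is2Design D v 2 lam → 2 < v → Block →
    PairwiseTransitive D (whole (Aut D)) → lam ≡ 1
  -- `lam = 0` fails because `β` itself joins its two points.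
  transitive-edges⇒lam≡1 {lam = zero} des _ β _ with block-pair des β
  ... | p , q , p≢q , pβ , qβ with () ← to (pair-count des p q p≢q) (β , pβ , qβ)
  transitive-edges⇒lam≡1 {lam = suc zero}    _   _   _ _  = refl
  transitive-edges⇒lam≡1 {lam = suc (suc _)} des 2<v β pt =
    contradiction pt (repeated-edge⇒¬transitive des 2<v β)

  k≤v : Is2Design D v k lam → Block → k ≤ v
  k≤v des β = subset-size-≤ I-irrelevant
    (subst (HasSize Point) (v-points des) points-finite) (block-size des β)

lemma2p1 : (D : Design) (v k lam : ℕ) → Is2Design D v k lam →
    0 < Design.numBlocks D →
    (Trivial v k × PairwiseTransitive D (whole (Aut D)))
    ⇔ ((k ≡ 2 × lam ≡ 1) ⊎ (k ≡ v × lam ≡ Design.numBlocks D))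
lemma2p1 D v k lam des 0<b = mk⇔ forward backward
  where
  open Design D

  -- Without blocks, `block-size` would not tie `k` to the design: some `k > v` with `k > 2` would
  -- be trivial and pairwise transitive, yet satisfy neither alternative.
  β : Block
  β = from blocks-finite (fromℕ< 0<b)

  forward : Trivial v k × PairwiseTransitive D (whole (Aut D)) →
            (k ≡ 2 × lam ≡ 1) ⊎ (k ≡ v × lam ≡ numBlocks)
  forward (trivial , pt) with k ≟ v
  ... | yes k≡v = inj₂ (k≡v , full⇒lam≡numBlocks des β (k≡v⇒full des k≡v))
  -- Now `k < v`, so triviality leaves only `k = 2`; matching `refl` for it turns the strict bound
  -- into `2 < v`.
  ... | no  k≢v with k ≟ 2 | ≤∧≢⇒< (k≤v des β) k≢v
  ...   | yes refl | 2<v = inj₁ (refl , transitive-edges⇒lam≡1 des 2<v β pt)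
  ...   | no  k≢2  | k<v = contradiction (≤∧≢⇒< (Is2Design.2≤k des) (≢-sym k≢2) , k<v) trivial

  backward : (k ≡ 2 × lam ≡ 1) ⊎ (k ≡ v × lam ≡ numBlocks) →
             Trivial v k × PairwiseTransitive D (whole (Aut D))
  backward (inj₁ (refl , refl)) = <-irrefl refl ∘ proj₁ , edges-pairwiseTransitive des
  backward (inj₂ (refl , _)) = <-irrefl refl ∘ proj₂
    , full⇒pairwiseTransitive D (proj₁ (block-pair des β)) (k≡v⇒full des refl)
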